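{- There exists a covering system of the integers whose moduli are all odd and greater than $1$, in which exactly five congruences have modulus $21$ and the congruences with moduli different from $21$ have pairwise distinct moduli.
   Context: A covering system is a finite collection of congruences $r_i\pmod{m_i}$ such that every integer satisfies at least one of them. -}

module Defs where

open import Data.Nat using (ℕ; _<_; _%_)
open import Data.Nat.Properties using (_≟_)
open import Data.Integer using (ℤ; +_; _-_)
open import Data.Integer.Divisibility using (_∣_)
open import Data.List using (List; length; filter)
open import Data.List.Relation.Unary.All using (All)
open import Data.List.Relation.Unary.Any using (Any)
open import Data.List.Relation.Unary.AllPairs using (AllPairs)
open import Data.List.Relation.Unary.Unique.Propositional using (Unique)
open import Data.Product using (_×_)
open import Relation.Binary.PropositionalEquality using (_≡_; _≢_)

-- A congruence  x ≡ residue (mod modulus), with residue in canonical form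
-- 0 ≤ residue < modulus (so two congruences are the same residue class
-- iff they are equal as records).
record Congruence : Set where
  constructor _mod_
  field
    residue : ℕ
    modulus : ℕ
open Congruence public

Satisfies : ℤ → Congruence → Set
Satisfies x c = (+ modulus c) ∣ (x - + residue c)

Odd : ℕ → Set
Odd m = m % 2 ≡ 1

IsCoveringSystem : List Congruence → Set
IsCoveringSystem cs =
  Unique cs
  × All (λ c → 1 Data.Nat.≤ modulus c × residue c < modulus c) cs
  × (∀ (x : ℤ) → Any (Satisfies x) cs)

countModulus : ℕ → List Congruence → ℕ
countModulus m cs = length (filter (λ c → modulus c ≟ m) cs)

{-# OPTIONS --safe #-}

-- The primes 3, 7, 5, 11, 13, 17, 19 are brought in one after the other.  If H is the set of residues
-- modulo L left uncovered so far and p is the next prime, then H splits into p copies of itself, one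
-- for each residue modulo p, and every divisor d of L provides one modulus p * d, with which a residue
-- class modulo d can be removed from one of these copies.  The moduli p ^ 2 * d, p ^ 3 * d, … repeat
-- the same pattern inside the copy over 0, so that only a thin class 0 (mod p ^ n) of H escapes
-- entirely.  Thanks to the five congruences modulo 21, the rest of H is exhausted at p = 17.
-- The thin classes around the accumulation points at 3, 5, 11 and 13 have not used any modulus
-- divisible by 19, and these suffice to cover them.  The residues were found by a computer search;
-- that they cover ℤ is checked by splitting residue classes prime by prime until each is contained
-- in one of the congruences.
module Submission where

open import Defs
open import Data.Bool.Base using (Bool; true; false; T; not; _∧_; _∨_; if_then_else_)
open import Data.Bool.ListAction using (any; all)
open import Data.Bool.Properties using (T-∧; T-∨; T-≡)
open import Data.Integer.Base as ℤ using (ℤ; +_)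
open import Data.Integer.Divisibility.Signed using (divides; ∣⇒∣ᵤ)
open import Data.Integer.DivMod using (_%ℕ_; _/ℕ_; a≡a%ℕn+[a/ℕn]*n; n%ℕd<d)
open import Data.Integer.Properties using (pos-*; +-identityˡ; *-identityʳ)
open import Data.Integer.Tactic.RingSolver using (solve-∀)
open import Data.List
  using (List; []; _∷_; _++_; [_]; map; concat; concatMap; zipWith; foldl; filterᵇ; merge; null;
         upTo; applyUpTo; cartesianProductWith)
open import Data.List.Membership.Propositional.Properties using (∈-upTo⁺; ∈-++⁻)
open import Data.List.Relation.Binary.Subset.Propositional using (_⊆_)
open import Data.List.Relation.Binary.Subset.Propositional.Properties
  using (Any-resp-⊆; filter-⊆; ⊆-refl; ⊆-trans)
open import Data.List.Relation.Unary.All as All using (All; all?)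
open import Data.List.Relation.Unary.All.Properties using (all⁺)
open import Data.List.Relation.Unary.AllPairs as AllPairs using (AllPairs)
open import Data.List.Relation.Unary.Any as Any using (Any)
open import Data.List.Relation.Unary.Any.Properties using (any⁻)
open import Data.List.Relation.Unary.Linked using (Linked; linked?)
open import Data.List.Relation.Unary.Linked.Properties using (Linked⇒AllPairs)
open import Data.Nat using (ℕ; zero; suc; _+_; _*_; _^_; _/_; _%_; _<_; _≡ᵇ_; _≤ᵇ_; _<?_)
open import Data.Nat.DivMod using (m≡m%n+[m/n]*n)
open import Data.Nat.GeneralisedArithmetic using (fold)
open import Data.Nat.Properties using (_≟_; <-trans; <-irrefl; <⇒≤; ≡ᵇ⇒≡)
open import Data.Product using (_×_; _,_; ∃-syntax)
open import Data.Sum using (_⊎_; inj₁; inj₂; [_,_]′)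
open import Data.Unit using (tt)
open import Function.Base using (_∘_)
open import Function.Bundles using (Equivalence)
open import Relation.Binary.Definitions using (Transitive) renaming (Decidable to Decidable₂)
open import Relation.Binary.PropositionalEquality
  using (_≡_; _≢_; refl; sym; trans; cong; cong₂; subst; module ≡-Reasoning)
open import Relation.Nullary.Decidable using (_×-dec_; _⊎-dec_; T?; toWitness)
open import Relation.Unary using () renaming (Decidable to Decidable₁)

-- Searching for uncovered residue classes

rem : ℕ → ℕ → ℕ
rem m zero    = m
rem m (suc n) = m % suc n

_divides?_ : ℕ → ℕ → Bool
q divides? m = rem m q ≡ᵇ 0

_contains_ : Congruence → Congruence → Bool
(ρ mod zero)  contains (r mod m) = false
(ρ mod suc d) contains (r mod m) = (m % suc d ≡ᵇ 0) ∧ (r % suc d ≡ᵇ ρ)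

refinableAt unrefinableAt : ℕ → List Congruence → List Congruence
refinableAt   q = filterᵇ (λ c → q divides? modulus c)
unrefinableAt q = filterᵇ (λ c → not (q divides? modulus c))

havingResidue : (ρ q : ℕ) → List Congruence → List Congruence
havingResidue ρ q = filterᵇ (λ c → rem (residue c) q ≡ᵇ ρ)

-- (c , ps): inside the class c the search ignores congruences whose modulus has a prime factor in
-- ps.  This only saves time; discarding congruences can never make a class look covered.
Pruning : Set
Pruning = Congruence × List ℕ

prune : List Pruning → ℕ → ℕ → List Congruence → List Congruence
prune []                       r q cs = cs
prune (((ρ mod μ) , ps) ∷ rules) r q cs =
  if (μ ≡ᵇ q) ∧ (rem r q ≡ᵇ ρ)
  then filterᵇ (λ c → not (any (_divides? modulus c) ps)) cs
  else prune rules r q cs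

module Search (rules : List Pruning) where

  -- In  covers fuel (p ∷ ps) q (r mod m) cs  the number q is the exact power of p dividing m, and
  -- cs consists of congruences compatible with r mod m.  Whether a congruence meets a subclass
  -- modulo m * p depends on the subclass only if q * p divides its modulus.
  mutual
    covers : ℕ → List ℕ → ℕ → Congruence → List Congruence → Bool
    covers zero       ps           q c         cs = false
    covers (suc fuel) []           q c         cs = false
    covers (suc fuel) (zero ∷ ps)  q c         cs = false
    covers (suc fuel) (suc p ∷ ps) q (r mod m) cs =
      let refinable = refinableAt (q * suc p) cs
          others    = unrefinableAt (q * suc p) cs
      in if null refinable
         then covers fuel ps 1 (r mod m) others
         else all (λ j → coversSubclass fuel (suc p) ps (q * suc p)
                           ((r + j * m) mod (m * suc p)) refinable others)
                  (upTo (suc p))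

    coversSubclass : ℕ → ℕ → List ℕ → ℕ → Congruence → (refinable others : List Congruence) → Bool
    coversSubclass fuel p ps q (r mod m) refinable others =
      let compatible = havingResidue (rem r q) q refinable
      -- A member of `others` containing this subclass would already contain the parent class,
      -- because its modulus lacks the factor `q`.
      in any (_contains (r mod m)) compatible
         ∨ covers fuel (p ∷ ps) q (r mod m) (prune rules r q (compatible ++ others))

-- Soundness of the search

_∈ᶜ_ : ℤ → Congruence → Set
x ∈ᶜ (r mod m) = ∃[ k ] x ≡ + r ℤ.+ k ℤ.* + m

-- Dividing the quotient `k` by `suc p` selects the subclass: the remainder is `j`, and `k′` is the
-- new quotient.
∈ᶜ-refine : ∀ {x} r m p → x ∈ᶜ (r mod m) →
            ∃[ j ] j < suc p × x ∈ᶜ ((r + j * m) mod (m * suc p))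
∈ᶜ-refine {x} r m p (k , x≡) = j , n%ℕd<d k (suc p) , k′ , (begin
  x
    ≡⟨ x≡ ⟩
  + r ℤ.+ k ℤ.* + m
    ≡⟨ cong (λ k → + r ℤ.+ k ℤ.* + m) (a≡a%ℕn+[a/ℕn]*n k (suc p)) ⟩
  + r ℤ.+ (+ j ℤ.+ k′ ℤ.* + suc p) ℤ.* + m
    ≡⟨ regroup (+ r) (+ j) k′ (+ m) (+ suc p) ⟩
  (+ r ℤ.+ + j ℤ.* + m) ℤ.+ k′ ℤ.* (+ m ℤ.* + suc p)
    ≡⟨ cong₂ (λ a b → (+ r ℤ.+ a) ℤ.+ k′ ℤ.* b) (pos-* j m) (pos-* m (suc p)) ⟨
  + (r + j * m) ℤ.+ k′ ℤ.* + (m * suc p)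
    ∎)
  where
  open ≡-Reasoning
  j  = k %ℕ suc p
  k′ = k /ℕ suc p
  regroup : ∀ r j k m p → r ℤ.+ (j ℤ.+ k ℤ.* p) ℤ.* m ≡ (r ℤ.+ j ℤ.* m) ℤ.+ k ℤ.* (m ℤ.* p)
  regroup = solve-∀

contains-sound : ∀ {x} c d → T (c contains d) → x ∈ᶜ d → Satisfies x c
contains-sound {x} (ρ mod suc n) (r mod m) c∋d (k , x≡)
  with m%D≡ᵇ0 , r%D≡ᵇρ ← Equivalence.to T-∧ c∋d =
  ∣⇒∣ᵤ (divides (+ (r / D) ℤ.+ k ℤ.* + (m / D)) (begin
    x ℤ.- + ρ
      ≡⟨ cong (ℤ._- + ρ) x≡ ⟩
    + r ℤ.+ k ℤ.* + m ℤ.- + ρ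
      ≡⟨ cong₂ (λ r m → r ℤ.+ k ℤ.* m ℤ.- + ρ)
               (trans (decompose r) (cong (λ a → + a ℤ.+ + (r / D) ℤ.* + D) (≡ᵇ⇒≡ _ _ r%D≡ᵇρ)))
               (trans (decompose m) (trans (cong (λ a → + a ℤ.+ + (m / D) ℤ.* + D)
                                                 (≡ᵇ⇒≡ _ _ m%D≡ᵇ0))
                                           (+-identityˡ _))) ⟩
    + ρ ℤ.+ + (r / D) ℤ.* + D ℤ.+ k ℤ.* (+ (m / D) ℤ.* + D) ℤ.- + ρ
      ≡⟨ regroup (+ ρ) (+ (r / D)) k (+ (m / D)) (+ D) ⟩
    (+ (r / D) ℤ.+ k ℤ.* + (m / D)) ℤ.* + D
      ∎))
  where
  open ≡-Reasoning
  D = suc n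
  decompose : ∀ a → + a ≡ + (a % D) ℤ.+ + (a / D) ℤ.* + D
  decompose a = trans (cong +_ (m≡m%n+[m/n]*n a D)) (cong (λ b → + (a % D) ℤ.+ b) (pos-* (a / D) D))
  regroup : ∀ ρ a k b d → ρ ℤ.+ a ℤ.* d ℤ.+ k ℤ.* (b ℤ.* d) ℤ.- ρ ≡ (a ℤ.+ k ℤ.* b) ℤ.* d
  regroup = solve-∀

filterᵇ-⊆ : ∀ {A : Set} (p : A → Bool) xs → filterᵇ p xs ⊆ xs
filterᵇ-⊆ p = filter-⊆ (T? ∘ p)

prune-⊆ : ∀ rules r q cs → prune rules r q cs ⊆ cs
prune-⊆ []                         r q cs = ⊆-refl
prune-⊆ (((ρ mod μ) , ps) ∷ rules) r q cs with (μ ≡ᵇ q) ∧ (rem r q ≡ᵇ ρ)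
... | true  = filterᵇ-⊆ (λ c → not (any (_divides? modulus c) ps)) cs
... | false = prune-⊆ rules r q cs

T-if : ∀ b {x y} → T (if b then x else y) → T x ⊎ T y
T-if true  = inj₁
T-if false = inj₂

++-⊆ : ∀ {A : Set} {xs ys zs : List A} → xs ⊆ zs → ys ⊆ zs → xs ++ ys ⊆ zs
++-⊆ {xs = xs} xs⊆zs ys⊆zs = [ xs⊆zs , ys⊆zs ]′ ∘ ∈-++⁻ xs

module _ (rules : List Pruning) where
  open Search rules

  mutual
    -- Every list handed down by the search is a sublist of `cs`, so a congruence found in it lies
    -- in `cs`; by `∈ᶜ-refine` the subclasses tested exhaust the class.
    covers-sound : ∀ {x} fuel ps q c cs → T (covers fuel ps q c cs) →
                   x ∈ᶜ c → Any (Satisfies x) cs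
    covers-sound (suc fuel) (suc p ∷ ps) q (r mod m) cs ok x∈
      with T-if (null (refinableAt (q * suc p) cs)) ok
    ... | inj₁ ok′ = Any-resp-⊆ (filterᵇ-⊆ _ cs)
                       (covers-sound fuel ps 1 (r mod m) (unrefinableAt (q * suc p) cs) ok′ x∈)
    ... | inj₂ ok′ with j , j<p , x∈ⱼ ← ∈ᶜ-refine r m p x∈ =
      coversSubclass-sound fuel (suc p) ps (q * suc p) ((r + j * m) mod (m * suc p))
        {refinableAt (q * suc p) cs} {unrefinableAt (q * suc p) cs}
        (filterᵇ-⊆ _ cs) (filterᵇ-⊆ _ cs)
        (All.lookup (all⁺ _ (upTo (suc p)) ok′) (∈-upTo⁺ j<p)) x∈ⱼ

    coversSubclass-sound : ∀ {x cs} fuel p ps q c {refinable others} →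
                           refinable ⊆ cs → others ⊆ cs →
                           T (coversSubclass fuel p ps q c refinable others) →
                           x ∈ᶜ c → Any (Satisfies x) cs
    coversSubclass-sound fuel p ps q c@(r mod m) {refinable} {others} refinable⊆ others⊆ ok x∈
      with Equivalence.to T-∨ ok
    ... | inj₁ hit = Any-resp-⊆ (⊆-trans (filterᵇ-⊆ _ refinable) refinable⊆)
                       (Any.map (λ {d} d∋c → contains-sound d c d∋c x∈)
                         (any⁻ (_contains (r mod m)) (havingResidue (rem r q) q refinable) hit))
    ... | inj₂ ok′ = Any-resp-⊆
                       (⊆-trans (prune-⊆ rules r q _)
                         (++-⊆ (⊆-trans (filterᵇ-⊆ _ refinable) refinable⊆) others⊆))
                       (covers-sound fuel (p ∷ ps) q c _ ok′ x∈)

-- Decidable criterion for a list ordered by modulus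

Admissible : Congruence → Set
Admissible c = Odd (modulus c) × 1 < modulus c × residue c < modulus c

-- A transitive relation that forces distinctness: comparing neighbours in one pass settles all
-- pairs. Equal moduli are tolerated only at 21, where the residues must increase.
_≺_ : Congruence → Congruence → Set
c ≺ d = modulus c < modulus d ⊎ (modulus c ≡ 21 × modulus d ≡ 21 × residue c < residue d)

primes : List ℕ
primes = 3 ∷ 7 ∷ 5 ∷ 11 ∷ 13 ∷ 17 ∷ 19 ∷ []

WellFormed : List Congruence → Set
WellFormed cs = All Admissible cs × Linked _≺_ cs × countModulus 21 cs ≡ 5

-- The highest prime powers in `covering` are 3^16, 7^2, 5^7, 11^2, 13^2, 17 and 19, so a branch has
-- at most 31 refinements and 7 changes of prime; the fuel 100 suffices.
coversEverything : List Pruning → List Congruence → Bool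
coversEverything rules = Search.covers rules 100 primes 1 (0 mod 1)

_≺?_ : Decidable₂ _≺_
c ≺? d = (modulus c <? modulus d) ⊎-dec
         ((modulus c ≟ 21) ×-dec (modulus d ≟ 21) ×-dec (residue c <? residue d))

wellFormed? : Decidable₁ WellFormed
wellFormed? cs =
  all? (λ c → (modulus c % 2 ≟ 1) ×-dec (1 <? modulus c) ×-dec (residue c <? modulus c)) cs ×-dec
  linked? _≺?_ cs ×-dec (countModulus 21 cs ≟ 5)

≺-trans : Transitive _≺_
≺-trans {c} (inj₁ c<d)             (inj₁ d<e)                = inj₁ (<-trans c<d d<e)
≺-trans {c} (inj₁ c<d)             (inj₂ (d≡21 , e≡21 , _))  =
  inj₁ (subst (modulus c <_) (trans d≡21 (sym e≡21)) c<d)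
≺-trans {k = e} (inj₂ (c≡21 , d≡21 , _)) (inj₁ d<e)          =
  inj₁ (subst (_< modulus e) (trans d≡21 (sym c≡21)) d<e)
≺-trans (inj₂ (c≡21 , _ , c<d))    (inj₂ (_ , e≡21 , d<e))   = inj₂ (c≡21 , e≡21 , <-trans c<d d<e)

≺⇒≢ : ∀ {c d} → c ≺ d → c ≢ d
≺⇒≢ (inj₁ c<d)           refl = <-irrefl refl c<d
≺⇒≢ (inj₂ (_ , _ , c<d)) refl = <-irrefl refl c<d

≺⇒distinctModuli : ∀ {c d} → c ≺ d → modulus c ≢ 21 → modulus d ≢ 21 → modulus c ≢ modulus d
≺⇒distinctModuli (inj₁ c<d)        _     _ c≡d = <-irrefl c≡d c<d
≺⇒distinctModuli (inj₂ (c≡21 , _)) c≢21  _ _   = c≢21 c≡21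

wellFormed-covering : ∀ rules {cs} → WellFormed cs → coversEverything rules cs ≡ true →
  IsCoveringSystem cs
    × All (λ c → Odd (modulus c) × 1 < modulus c) cs
    × countModulus 21 cs ≡ 5
    × AllPairs (λ c d → modulus c ≢ 21 → modulus d ≢ 21 → modulus c ≢ modulus d) cs
wellFormed-covering rules {cs} (admissible , linked , count) ok =
  ( AllPairs.map ≺⇒≢ ordered
  , All.map (λ (_ , 1<m , r<m) → <⇒≤ 1<m , r<m) admissible
  , λ x → covers-sound rules 100 primes 1 (0 mod 1) cs (Equivalence.from T-≡ ok)
               (x , sym (trans (+-identityˡ _) (*-identityʳ x)))
  ) , All.map (λ (odd , 1<m , _) → odd , 1<m) admissible , count , AllPairs.map ≺⇒distinctModuli ordered
  where
  ordered = Linked⇒AllPairs ≺-trans linked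

-- The congruences

-- A pair (p , p ^ e + r) with r ≤ p ^ e stands for the condition  x ≡ r (mod p ^ e).
Address : Set
Address = List (ℕ × ℕ)

-- A Chinese remainder step: if q / p is the exact power of p in `m` and `r` agrees with `n` modulo
-- q / p, exactly one of r, r + m, ..., r + (p - 1) * m agrees with `n` modulo `q`. Fuel p therefore
-- suffices.
findDigit : ℕ → ℕ → ℕ → ℕ → ℕ → ℕ
findDigit zero       n q m r = r
findDigit (suc fuel) n q m r = if rem r q ≡ᵇ rem n q then r else findDigit fuel n q m (r + m)

-- The exponent is recovered as the largest e with p ^ e ≤ n. The bound 20 exceeds the largest
-- exponent used, which is 16.
impose : Congruence → ℕ × ℕ → Congruence
impose c (p , n) = go 20 p c
  where
  go : ℕ → ℕ → Congruence → Congruence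
  go zero       q c         = c
  go (suc fuel) q (r mod m) =
    if q ≤ᵇ n then go fuel (q * p) (findDigit p n q m r mod (m * p)) else (r mod m)

congruence : Address → Congruence
congruence = foldl impose (0 mod 1)

infixr 6 _⊗_
-- Joining addresses imposes both conditions, so these are the pairwise intersections of classes.
_⊗_ : List Address → List Address → List Address
_⊗_ = cartesianProductWith _++_

everywhere : List Address
everywhere = [ [] ]

at : ℕ → ℕ → List Address
at p n = [ [ (p , n) ] ]

-- The classes  s + d * p ^ e  modulo p ^ (e + 1)  for a ≤ e < a + n.  With d running through
-- 1, …, p - 1 they fill  s (mod p ^ a)  except for  s (mod p ^ (a + n)).
tower : (p s d a n : ℕ) → List Address
tower p s d a n = applyUpTo (λ i → [ (p , (p + d) * p ^ (a + i) + s) ]) n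

three : (s d n : ℕ) → List Address
three s d n = tower 3 s d 1 n

seven sub five eleven thirteen seventeen : ℕ → List Address
seven c     = at 7 (7 + c)
sub j       = at 7 (49 + 7 * j)
five d      = tower 5 0 d 0 7
eleven d    = tower 11 0 d 0 2
thirteen d  = tower 13 0 d 0 2
seventeen d = at 17 (17 + d)

-- Moduli composed of 3, 5 and 7

-- After the primes 3, 5 and 7 the bulk of the uncovered set is the union of the classes
-- three 1 1 7 ⊗ five 3  in the columns 1, …, 4 modulo 7 and in one class modulo 49.
smooth : List Address
smooth =
     at 3 3
  ++ three 1 2 15
  ++ seven 6
  -- The five congruences modulo 21. Since `seven 6` takes column 6, only column 5 of the class 2
  -- (mod 3) is left.
  ++ at 3 5 ⊗ concatMap seven (0 ∷ 1 ∷ 2 ∷ 3 ∷ 4 ∷ [])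
  ++ three 2 2 15 ⊗ seven 5
  -- Column 0 is split modulo 49: three parts go here, three more on `five 3` below, and `sub 6`
  -- remains.
  ++ (everywhere ⊗ sub 0 ++ at 3 4 ⊗ sub 1 ++ three 1 1 15 ⊗ sub 2)
  ++ five 1
  ++ (three 1 1 15 ++ three 2 1 15 ⊗ seven 5) ⊗ five 2
  ++ (seven 5 ++ sub 3 ++ at 3 4 ⊗ sub 4 ++ three 1 1 15 ⊗ sub 5) ⊗ five 3
  ++ (at 3 4 ++ at 3 5 ⊗ seven 5) ⊗ five 4

-- Moduli with largest prime factor 11, 13 or 17

-- Each of these six families covers all of  three 1 1 7 ⊗ five 3, so every product of 7, 11, 13 and
-- 17 can be used six times on the bulk, once with each family.
families : List (List Address)
families = cartesianProductWith _⊗_ (everywhere ∷ five 3 ∷ [])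
                                    (everywhere ∷ at 3 4 ∷ three 1 1 7 ∷ [])

-- Families differ in whether the exponent of 3 is 0, 1 or larger, or in whether 5 occurs, which
-- keeps the moduli distinct when the entries share a product of the other primes. A list with fewer
-- than six entries uses only the first families.
spread : List (List Address) → List Address
spread = concat ∘ zipWith _⊗_ families

-- Since 0 encodes the absence of a condition, the residue 0 modulo 17 is written as 17 in the
-- cells.
unless0 : (ℕ → List Address) → ℕ → List Address
unless0 f zero      = everywhere
unless0 f d@(suc _) = f d

cell : ℕ × ℕ × ℕ × ℕ → List Address
cell (c , e , t , s) =
  unless0 seven c ⊗ unless0 eleven e ⊗ unless0 thirteen t ⊗ unless0 seventeen s

-- The entries of a row belong to the successive families.
cells : List (List (ℕ × ℕ × ℕ × ℕ))
cells =
    ( (0 , 1 , 0 , 0) ∷ (0 , 2 , 0 , 0) ∷ (0 , 3 , 0 , 0) ∷ (0 , 4 , 0 , 0) ∷ (0 , 5 , 0 , 0) ∷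
      (0 , 6 , 0 , 0) ∷ [] )
  ∷ ( (3 , 8 , 0 , 0) ∷ (4 , 8 , 0 , 0) ∷ (3 , 9 , 0 , 0) ∷ (4 , 9 , 0 , 0) ∷ (3 , 10 , 0 , 0) ∷
      (4 , 10 , 0 , 0) ∷ [] )
  ∷ ( (0 , 0 , 1 , 0) ∷ (0 , 0 , 2 , 0) ∷ (0 , 0 , 3 , 0) ∷ (0 , 0 , 4 , 0) ∷ (0 , 0 , 5 , 0) ∷
      (0 , 0 , 6 , 0) ∷ [] )
  ∷ ( (2 , 0 , 7 , 0) ∷ (1 , 0 , 7 , 0) ∷ (2 , 0 , 8 , 0) ∷ (1 , 0 , 8 , 0) ∷ (2 , 0 , 9 , 0) ∷
      (1 , 0 , 9 , 0) ∷ [] )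
  ∷ ( (0 , 7 , 7 , 0) ∷ (0 , 7 , 9 , 0) ∷ (0 , 7 , 10 , 0) ∷ (0 , 8 , 10 , 0) ∷ (0 , 9 , 10 , 0) ∷
      (0 , 7 , 11 , 0) ∷ [] )
  ∷ ( (3 , 7 , 8 , 0) ∷ (4 , 7 , 8 , 0) ∷ (1 , 10 , 10 , 0) ∷ (2 , 10 , 10 , 0) ∷
      (2 , 8 , 11 , 0) ∷ (2 , 9 , 11 , 0) ∷ [] )
  -- Up to thin classes, with (e , t) the digits at 11 and 13, the bulk has shrunk to (7 , 12) in
  -- columns 3 and 4, t = 12 with e = 7, ..., 10 in columns 1 and 2, t = 11 with e = 8, 9, 10 in
  -- column 1, and (10 , 11) in column 2. The remaining rows exhaust it.
  ∷ ( (0 , 0 , 0 , 1) ∷ (0 , 0 , 0 , 2) ∷ (0 , 0 , 0 , 3) ∷ (0 , 0 , 0 , 4) ∷ (0 , 0 , 0 , 5) ∷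
      (0 , 0 , 0 , 6) ∷ [] )
  ∷ ( (1 , 0 , 0 , 13) ∷ (2 , 0 , 0 , 13) ∷ (1 , 0 , 0 , 14) ∷ (2 , 0 , 0 , 14) ∷
      (1 , 0 , 0 , 15) ∷ (2 , 0 , 0 , 15) ∷ [] )
  ∷ ( (0 , 10 , 0 , 16) ∷ (0 , 9 , 0 , 16) ∷ (0 , 8 , 0 , 16) ∷ (0 , 10 , 0 , 17) ∷
      (0 , 8 , 0 , 17) ∷ (0 , 9 , 0 , 17) ∷ [] )
  ∷ ( (0 , 0 , 12 , 7) ∷ (0 , 0 , 12 , 8) ∷ (0 , 0 , 12 , 9) ∷ (0 , 0 , 12 , 10) ∷
      (0 , 0 , 12 , 11) ∷ (0 , 0 , 12 , 12) ∷ [] )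
  ∷ ( (1 , 0 , 11 , 7) ∷ (1 , 0 , 11 , 8) ∷ (1 , 0 , 11 , 9) ∷ (1 , 0 , 11 , 10) ∷
      (1 , 0 , 11 , 11) ∷ (1 , 0 , 11 , 12) ∷ [] )
  ∷ ( (0 , 7 , 12 , 13) ∷ (0 , 7 , 12 , 14) ∷ (0 , 7 , 12 , 15) ∷ (0 , 7 , 12 , 16) ∷
      (0 , 7 , 12 , 17) ∷ [] )
  ∷ ( (2 , 10 , 11 , 7) ∷ (2 , 10 , 11 , 8) ∷ (2 , 10 , 11 , 9) ∷ (2 , 10 , 11 , 10) ∷
      (2 , 10 , 11 , 11) ∷ (2 , 10 , 11 , 12) ∷ [] )
  ∷ []

bulk : List Address
-- The first row of `cells` removes the digits 1, ..., 6 at 11; removing 7, ..., 10 on `sub 6`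
-- finishes that class up to 0 (mod 121).
bulk = spread (map (λ e → sub 6 ⊗ eleven e) (7 ∷ 8 ∷ 9 ∷ 10 ∷ []))
    ++ concatMap (spread ∘ map cell) cells

-- Moduli divisible by 19

-- The entry (a , b , c , d , e) of the n-th row, counted from 0, is the congruence with the
-- addresses a, …, e at 3, 7, 5, 11, 13 (where 1 imposes no condition) and residue n modulo 19.
thin : List (List (ℕ × ℕ × ℕ × ℕ × ℕ))
thin =
    ( (1 , 1 , 1 , 1 , 1) ∷ [] )
  ∷ ( (4 , 1 , 1 , 1 , 1) ∷ (5 , 12 , 78125 , 1 , 1) ∷ (43046723 , 12 , 7 , 1 , 1) ∷
      (43046723 , 12 , 35 , 1 , 1) ∷ (43046723 , 12 , 175 , 1 , 1) ∷
      (43046723 , 12 , 875 , 1 , 1) ∷ (43046723 , 12 , 4375 , 1 , 1) ∷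
      (43046723 , 12 , 21875 , 1 , 1) ∷ (43046723 , 12 , 109375 , 1 , 1) ∷ [] )
  ∷ ( (1 , 1 , 8 , 1 , 1) ∷ (1 , 1 , 25 , 1 , 1) ∷ (1 , 1 , 40 , 11 , 1) ∷
      (6562 , 1 , 40 , 1 , 1) ∷ (1 , 1 , 40 , 1 , 13) ∷ (43046722 , 1 , 7 , 1 , 1) ∷
      (43046722 , 1 , 35 , 1 , 1) ∷ (43046723 , 12 , 1 , 1 , 1) ∷ [] )
  ∷ ( (4 , 1 , 8 , 1 , 1) ∷ (1 , 1 , 125 , 1 , 1) ∷ (4 , 1 , 40 , 11 , 1) ∷
      (2188 , 1 , 40 , 1 , 1) ∷ (1 , 1 , 40 , 1 , 169) ∷ (1 , 1 , 200 , 11 , 1) ∷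
      (6562 , 1 , 200 , 1 , 1) ∷ (1 , 1 , 200 , 1 , 13) ∷ (43046722 , 1 , 1 , 1 , 1) ∷
      (14348909 , 12 , 1 , 1 , 1) ∷ [] )
  ∷ ( (10 , 1 , 1 , 1 , 1) ∷ (13 , 1 , 1 , 11 , 1) ∷ (13 , 1 , 78125 , 1 , 1) ∷
      (13 , 1 , 1 , 1 , 13) ∷ (5 , 12 , 15625 , 1 , 1) ∷ (14348909 , 12 , 7 , 1 , 1) ∷
      (14348909 , 12 , 35 , 1 , 1) ∷ (14348909 , 12 , 175 , 1 , 1) ∷
      (14348909 , 12 , 875 , 1 , 1) ∷ (14348909 , 12 , 4375 , 1 , 1) ∷
      (14348909 , 12 , 21875 , 1 , 1) ∷ [] )
  ∷ ( (10 , 1 , 8 , 1 , 1) ∷ (1 , 1 , 625 , 1 , 1) ∷ (13 , 1 , 1 , 1 , 169) ∷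
      (13 , 1 , 1 , 121 , 1) ∷ (82 , 1 , 40 , 1 , 1) ∷ (37 , 1 , 40 , 11 , 1) ∷
      (244 , 1 , 200 , 1 , 1) ∷ (37 , 1 , 40 , 1 , 13) ∷ (109 , 1 , 40 , 11 , 1) ∷
      (37 , 1 , 200 , 11 , 1) ∷ (109 , 1 , 40 , 1 , 13) ∷ (2188 , 1 , 1000 , 1 , 1) ∷
      (37 , 1 , 200 , 1 , 13) ∷ (109 , 1 , 200 , 11 , 1) ∷ (37 , 1 , 1000 , 11 , 1) ∷
      (109 , 1 , 200 , 1 , 13) ∷ (37 , 1 , 1000 , 1 , 13) ∷ (325 , 1 , 200 , 11 , 1) ∷
      (109 , 1 , 1000 , 11 , 1) ∷ (325 , 1 , 200 , 1 , 13) ∷ (109 , 1 , 1000 , 1 , 13) ∷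
      (325 , 1 , 1000 , 11 , 1) ∷ (325 , 1 , 1000 , 1 , 13) ∷ (973 , 1 , 1000 , 11 , 1) ∷
      (973 , 1 , 1000 , 1 , 13) ∷ (2917 , 1 , 1000 , 11 , 1) ∷ (14348908 , 1 , 7 , 1 , 1) ∷
      (43046722 , 1 , 175 , 1 , 1) ∷ (2917 , 1 , 1000 , 1 , 13) ∷ (14348908 , 1 , 35 , 1 , 1) ∷
      (43046722 , 1 , 875 , 1 , 1) ∷ (4782971 , 12 , 1 , 1 , 1) ∷ [] )
  ∷ ( (28 , 1 , 1 , 1 , 1) ∷ (13 , 1 , 25 , 1 , 1) ∷ (13 , 1 , 8 , 11 , 1) ∷
      (1 , 1 , 1 , 1 , 13) ∷ (37 , 1 , 1 , 121 , 1) ∷ (37 , 1 , 78125 , 1 , 1) ∷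
      (5 , 12 , 3125 , 1 , 1) ∷ (13 , 1 , 40 , 121 , 1) ∷ (4782971 , 12 , 7 , 1 , 1) ∷
      (4782971 , 12 , 35 , 1 , 1) ∷ (4782971 , 12 , 175 , 1 , 1) ∷ (43046723 , 1 , 4375 , 1 , 1) ∷
      (4782971 , 12 , 875 , 1 , 1) ∷ [] )
  ∷ ( (82 , 1 , 1 , 1 , 1) ∷ (1 , 1 , 1 , 11 , 1) ∷ (1 , 1 , 78125 , 1 , 1) ∷
      (1 , 1 , 1 , 1 , 169) ∷ (14348909 , 1 , 1 , 1 , 1) ∷ [] )
  ∷ ( (4 , 1 , 1 , 11 , 1) ∷ (6562 , 1 , 1 , 1 , 1) ∷ (1 , 1 , 15625 , 1 , 1) ∷
      (4 , 1 , 1 , 1 , 13) ∷ (1594325 , 12 , 1 , 1 , 1) ∷ [] )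
  ∷ ( (1 , 8 , 1 , 1 , 1) ∷ (4 , 9 , 1 , 1 , 1) ∷ (1 , 12 , 25 , 1 , 1) ∷
      (6562 , 10 , 1 , 1 , 1) ∷ (1 , 10 , 1 , 121 , 1) ∷ (4 , 11 , 1 , 121 , 1) ∷
      (2188 , 11 , 1 , 1 , 1) ∷ (4 , 10 , 625 , 1 , 1) ∷ (4 , 11 , 125 , 1 , 1) ∷
      (1 , 10 , 1 , 18 , 13) ∷ (1 , 91 , 1 , 1 , 1) ∷ (1 , 11 , 1 , 18 , 169) ∷
      (1 , 70 , 78125 , 1 , 1) ∷ (4 , 77 , 78125 , 1 , 1) ∷ (1 , 84 , 15625 , 1 , 1) ∷
      (1 , 10 , 1 , 198 , 13) ∷ (1 , 11 , 1 , 198 , 169) ∷ (43046722 , 63 , 1 , 1 , 1) ∷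
      (43046722 , 70 , 7 , 1 , 1) ∷ (14348908 , 84 , 1 , 1 , 1) ∷ (43046722 , 70 , 35 , 1 , 1) ∷
      (43046722 , 70 , 175 , 1 , 1) ∷ (14348908 , 77 , 7 , 1 , 1) ∷
      (43046722 , 70 , 875 , 1 , 1) ∷ (14348908 , 77 , 35 , 1 , 1) ∷
      (43046722 , 70 , 4375 , 1 , 1) ∷ (14348908 , 77 , 175 , 1 , 1) ∷
      (14348908 , 77 , 875 , 1 , 1) ∷ (43046722 , 70 , 21875 , 1 , 1) ∷
      (14348908 , 77 , 4375 , 1 , 1) ∷ (1594324 , 12 , 7 , 1 , 1) ∷ (4782971 , 1 , 1 , 1 , 1) ∷
      (1594324 , 12 , 35 , 1 , 1) ∷ (14348908 , 77 , 21875 , 1 , 1) ∷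
      (43046722 , 70 , 109375 , 1 , 1) ∷ (14348908 , 77 , 109375 , 1 , 1) ∷ [] )
  ∷ ( (244 , 1 , 1 , 1 , 1) ∷ (1 , 1 , 3125 , 1 , 1) ∷ (1 , 1 , 1 , 121 , 1) ∷
      (4 , 1 , 1 , 1 , 169) ∷ (14348909 , 1 , 175 , 1 , 1) ∷ (4782971 , 1 , 7 , 1 , 1) ∷
      (14348909 , 1 , 875 , 1 , 1) ∷ (4782971 , 12 , 4375 , 1 , 1) ∷
      (4782971 , 1 , 35 , 1 , 1) ∷ [] )
  ∷ ( (730 , 1 , 1 , 1 , 1) ∷ (4 , 1 , 1 , 121 , 1) ∷ (4 , 1 , 78125 , 1 , 1) ∷
      (1 , 1 , 8 , 1 , 13) ∷ (4 , 1 , 40 , 1 , 13) ∷ (14 , 12 , 78125 , 1 , 1) ∷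
      (38 , 12 , 78125 , 1 , 1) ∷ (1 , 1 , 200 , 1 , 169) ∷ (110 , 12 , 78125 , 1 , 1) ∷
      (1 , 1 , 1000 , 1 , 13) ∷ (326 , 12 , 78125 , 1 , 1) ∷ (1 , 1 , 5000 , 1 , 13) ∷
      (974 , 12 , 78125 , 1 , 1) ∷ (2918 , 12 , 78125 , 1 , 1) ∷ (1 , 1 , 25000 , 1 , 13) ∷
      (8750 , 12 , 78125 , 1 , 1) ∷ (1 , 1 , 125000 , 1 , 13) ∷ (26246 , 12 , 78125 , 1 , 1) ∷
      (78734 , 12 , 78125 , 1 , 1) ∷ (236198 , 12 , 78125 , 1 , 1) ∷
      (708590 , 12 , 78125 , 1 , 1) ∷ (2125766 , 12 , 78125 , 1 , 1) ∷
      (6377294 , 12 , 78125 , 1 , 1) ∷ (19131878 , 12 , 78125 , 1 , 1) ∷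
      (4782971 , 12 , 15625 , 1 , 1) ∷ (1594325 , 12 , 175 , 1 , 1) ∷
      (14348909 , 1 , 4375 , 1 , 1) ∷ (43046723 , 1 , 21875 , 1 , 1) ∷
      (531443 , 12 , 1 , 1 , 1) ∷ [] )
  ∷ ( (2188 , 1 , 1 , 1 , 1) ∷ (1 , 1 , 8 , 11 , 1) ∷ (4 , 1 , 15625 , 1 , 1) ∷
      (1 , 1 , 8 , 1 , 169) ∷ (4 , 1 , 40 , 1 , 169) ∷ (1 , 1 , 40 , 121 , 1) ∷
      (14 , 12 , 15625 , 1 , 1) ∷ (4 , 1 , 200 , 11 , 1) ∷ (38 , 12 , 15625 , 1 , 1) ∷
      (4 , 1 , 200 , 1 , 13) ∷ (110 , 12 , 15625 , 1 , 1) ∷ (1 , 1 , 1000 , 11 , 1) ∷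
      (1 , 1 , 1000 , 1 , 169) ∷ (326 , 12 , 15625 , 1 , 1) ∷ (1 , 1 , 5000 , 11 , 1) ∷
      (974 , 12 , 15625 , 1 , 1) ∷ (1 , 1 , 5000 , 1 , 169) ∷ (2918 , 12 , 15625 , 1 , 1) ∷
      (1 , 1 , 25000 , 11 , 1) ∷ (1 , 1 , 25000 , 1 , 169) ∷ (8750 , 12 , 15625 , 1 , 1) ∷
      (26246 , 12 , 15625 , 1 , 1) ∷ (78734 , 12 , 15625 , 1 , 1) ∷
      (236198 , 12 , 15625 , 1 , 1) ∷ (708590 , 12 , 15625 , 1 , 1) ∷
      (2125766 , 12 , 15625 , 1 , 1) ∷ (6377294 , 1 , 78125 , 1 , 1) ∷
      (19131878 , 1 , 78125 , 1 , 1) ∷ (57395630 , 1 , 78125 , 1 , 1) ∷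
      (531443 , 12 , 7 , 1 , 1) ∷ (4782971 , 1 , 175 , 1 , 1) ∷ (1594325 , 12 , 875 , 1 , 1) ∷
      (14348909 , 1 , 15625 , 1 , 1) ∷ (531443 , 12 , 35 , 1 , 1) ∷
      (1594325 , 12 , 4375 , 1 , 1) ∷ (4782971 , 1 , 21875 , 1 , 1) ∷ [] )
  ∷ ( (28 , 1 , 8 , 1 , 1) ∷ (4 , 1 , 25 , 1 , 1) ∷ (13 , 1 , 8 , 1 , 13) ∷
      (13 , 1 , 8 , 121 , 1) ∷ (37 , 1 , 1 , 11 , 1) ∷ (244 , 1 , 40 , 1 , 1) ∷
      (37 , 1 , 1 , 1 , 13) ∷ (13 , 1 , 40 , 11 , 1) ∷ (14 , 12 , 3125 , 1 , 1) ∷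
      (13 , 1 , 40 , 1 , 13) ∷ (38 , 12 , 3125 , 1 , 1) ∷ (109 , 1 , 40 , 1 , 169) ∷
      (109 , 1 , 40 , 121 , 1) ∷ (110 , 12 , 3125 , 1 , 1) ∷ (325 , 1 , 40 , 11 , 1) ∷
      (326 , 12 , 3125 , 1 , 1) ∷ (325 , 1 , 40 , 1 , 13) ∷ (974 , 12 , 3125 , 1 , 1) ∷
      (2918 , 12 , 3125 , 1 , 1) ∷ (8750 , 12 , 3125 , 1 , 1) ∷ (26246 , 12 , 3125 , 1 , 1) ∷
      (78734 , 12 , 3125 , 1 , 1) ∷ (236198 , 12 , 3125 , 1 , 1) ∷ (708590 , 12 , 3125 , 1 , 1) ∷
      (1594324 , 1 , 1 , 1 , 1) ∷ (2125766 , 1 , 78125 , 1 , 1) ∷ (1594325 , 1 , 15625 , 1 , 1) ∷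
      (1594325 , 1 , 7 , 1 , 1) ∷ (4782971 , 1 , 875 , 1 , 1) ∷ (1594325 , 1 , 35 , 1 , 1) ∷
      (531443 , 12 , 175 , 1 , 1) ∷ (4782971 , 1 , 4375 , 1 , 1) ∷
      (1594325 , 1 , 3125 , 1 , 1) ∷ [] )
  ∷ ( (4 , 1 , 125 , 1 , 1) ∷ (4 , 1 , 8 , 11 , 1) ∷ (6562 , 1 , 8 , 1 , 1) ∷
      (4 , 1 , 8 , 1 , 13) ∷ (730 , 1 , 40 , 1 , 1) ∷ (4 , 1 , 40 , 121 , 1) ∷
      (13 , 1 , 40 , 1 , 169) ∷ (14 , 12 , 625 , 1 , 1) ∷ (37 , 1 , 40 , 1 , 169) ∷
      (38 , 12 , 625 , 1 , 1) ∷ (730 , 1 , 200 , 1 , 1) ∷ (4 , 1 , 200 , 1 , 169) ∷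
      (1 , 1 , 200 , 121 , 1) ∷ (110 , 12 , 625 , 1 , 1) ∷ (109 , 8 , 40 , 1 , 13) ∷
      (109 , 9 , 40 , 1 , 169) ∷ (325 , 1 , 40 , 1 , 169) ∷ (326 , 12 , 625 , 1 , 1) ∷
      (973 , 1 , 40 , 1 , 13) ∷ (109 , 10 , 40 , 18 , 13) ∷ (109 , 11 , 40 , 18 , 169) ∷
      (974 , 12 , 625 , 1 , 1) ∷ (109 , 10 , 40 , 198 , 13) ∷ (109 , 11 , 40 , 198 , 169) ∷
      (2918 , 12 , 625 , 1 , 1) ∷ (8750 , 1 , 78125 , 1 , 1) ∷ (26246 , 1 , 78125 , 1 , 1) ∷
      (78734 , 1 , 78125 , 1 , 1) ∷ (236198 , 1 , 78125 , 1 , 1) ∷ (708590 , 1 , 78125 , 1 , 1) ∷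
      (4782970 , 91 , 1 , 1 , 1) ∷ (4782970 , 63 , 7 , 1 , 1) ∷ (4782970 , 63 , 35 , 1 , 1) ∷
      (1594324 , 1 , 175 , 1 , 1) ∷ (531443 , 1 , 15625 , 1 , 1) ∷ (531442 , 1 , 1 , 1 , 1) ∷
      (177149 , 12 , 1 , 1 , 1) ∷ [] )
  ∷ ( (82 , 1 , 8 , 1 , 1) ∷ (4 , 1 , 625 , 1 , 1) ∷ (4 , 1 , 8 , 1 , 169) ∷
      (1 , 1 , 8 , 121 , 1) ∷ (28 , 1 , 40 , 1 , 1) ∷ (14 , 12 , 125 , 1 , 1) ∷
      (13 , 8 , 40 , 1 , 13) ∷ (13 , 9 , 40 , 1 , 169) ∷ (37 , 1 , 40 , 121 , 1) ∷
      (2188 , 1 , 200 , 1 , 1) ∷ (4 , 1 , 200 , 121 , 1) ∷ (38 , 12 , 125 , 1 , 1) ∷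
      (13 , 8 , 40 , 121 , 1) ∷ (13 , 1 , 200 , 1 , 13) ∷ (13 , 10 , 40 , 11 , 1) ∷
      (37 , 8 , 40 , 1 , 13) ∷ (37 , 9 , 40 , 1 , 169) ∷ (110 , 12 , 125 , 1 , 1) ∷
      (13 , 10 , 40 , 18 , 13) ∷ (13 , 11 , 40 , 18 , 169) ∷ (37 , 1 , 200 , 1 , 169) ∷
      (4 , 1 , 1000 , 11 , 1) ∷ (6562 , 1 , 1000 , 1 , 1) ∷ (1 , 9 , 40 , 121 , 1) ∷
      (4 , 11 , 40 , 121 , 1) ∷ (4 , 1 , 1000 , 1 , 13) ∷ (13 , 91 , 40 , 11 , 1) ∷
      (37 , 10 , 40 , 18 , 13) ∷ (37 , 11 , 40 , 18 , 169) ∷ (109 , 1 , 200 , 1 , 169) ∷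
      (13 , 11 , 40 , 198 , 13) ∷ (325 , 1 , 200 , 1 , 169) ∷ (37 , 10 , 40 , 198 , 13) ∷
      (37 , 11 , 40 , 198 , 169) ∷ (973 , 1 , 200 , 1 , 13) ∷ (326 , 12 , 125 , 1 , 1) ∷
      (2917 , 1 , 200 , 1 , 13) ∷ (974 , 1 , 78125 , 1 , 1) ∷ (2918 , 1 , 78125 , 1 , 1) ∷
      (8750 , 1 , 15625 , 1 , 1) ∷ (26246 , 1 , 15625 , 1 , 1) ∷ (78734 , 1 , 15625 , 1 , 1) ∷
      (236198 , 1 , 15625 , 1 , 1) ∷ (4782970 , 63 , 175 , 1 , 1) ∷ (531442 , 1 , 7 , 1 , 1) ∷
      (1594324 , 1 , 875 , 1 , 1) ∷ (708590 , 1 , 3125 , 1 , 1) ∷ (531442 , 1 , 35 , 1 , 1) ∷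
      (531442 , 1 , 175 , 1 , 1) ∷ (531443 , 12 , 625 , 1 , 1) ∷ (177149 , 12 , 7 , 1 , 1) ∷
      (177149 , 12 , 35 , 1 , 1) ∷ (177149 , 12 , 175 , 1 , 1) ∷ (177149 , 12 , 875 , 1 , 1) ∷ [] )
  ∷ ( (4 , 1 , 3125 , 1 , 1) ∷ (244 , 1 , 8 , 1 , 1) ∷ (4 , 1 , 8 , 121 , 1) ∷
      (13 , 1 , 8 , 1 , 169) ∷ (37 , 1 , 1 , 1 , 169) ∷ (26245 , 1 , 40 , 1 , 1) ∷
      (109 , 1 , 1 , 1 , 13) ∷ (5 , 12 , 25 , 1 , 1) ∷ (13 , 1 , 40 , 18 , 13) ∷
      (1 , 8 , 40 , 11 , 1) ∷ (4 , 9 , 40 , 11 , 1) ∷ (78733 , 1 , 40 , 1 , 1) ∷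
      (325 , 1 , 1 , 1 , 13) ∷ (13 , 1 , 200 , 11 , 1) ∷ (26245 , 1 , 200 , 1 , 1) ∷
      (13 , 1 , 200 , 1 , 169) ∷ (236197 , 1 , 40 , 1 , 1) ∷ (37 , 10 , 40 , 121 , 1) ∷
      (37 , 1 , 200 , 121 , 1) ∷ (78733 , 1 , 200 , 1 , 1) ∷ (1 , 1 , 1000 , 121 , 1) ∷
      (1 , 91 , 40 , 11 , 1) ∷ (37 , 11 , 40 , 11 , 1) ∷ (730 , 1 , 1000 , 1 , 1) ∷
      (13 , 1 , 1000 , 1 , 13) ∷ (109 , 10 , 40 , 121 , 1) ∷ (109 , 1 , 200 , 121 , 1) ∷
      (236197 , 1 , 200 , 1 , 1) ∷ (1 , 8 , 40 , 19 , 13) ∷ (1 , 8 , 40 , 20 , 169) ∷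
      (4 , 8 , 40 , 21 , 13) ∷ (4 , 9 , 40 , 19 , 169) ∷ (109 , 11 , 40 , 11 , 1) ∷
      (1 , 1 , 5000 , 121 , 1) ∷ (6562 , 1 , 5000 , 1 , 1) ∷ (325 , 10 , 40 , 121 , 1) ∷
      (13 , 10 , 40 , 198 , 169) ∷ (13 , 1 , 5000 , 1 , 13) ∷ (325 , 1 , 200 , 121 , 1) ∷
      (325 , 11 , 40 , 11 , 1) ∷ (973 , 1 , 40 , 18 , 13) ∷ (973 , 10 , 40 , 121 , 1) ∷
      (973 , 1 , 200 , 11 , 1) ∷ (973 , 11 , 40 , 11 , 1) ∷ (1 , 9 , 40 , 1 , 13) ∷
      (1 , 11 , 40 , 198 , 13) ∷ (973 , 1 , 200 , 1 , 169) ∷ (708589 , 91 , 40 , 1 , 1) ∷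
      (2917 , 10 , 40 , 121 , 1) ∷ (2917 , 1 , 200 , 11 , 1) ∷ (2917 , 11 , 40 , 11 , 1) ∷
      (13 , 10 , 40 , 1 , 1) ∷ (2917 , 1 , 200 , 1 , 169) ∷ (973 , 1 , 1000 , 1 , 169) ∷
      (2125765 , 91 , 40 , 1 , 1) ∷ (13 , 11 , 5 , 121 , 1) ∷ (2917 , 8 , 40 , 18 , 13) ∷
      (2917 , 10 , 40 , 18 , 169) ∷ (8749 , 10 , 40 , 121 , 1) ∷ (8749 , 1 , 200 , 11 , 1) ∷
      (708589 , 91 , 200 , 1 , 1) ∷ (8749 , 11 , 40 , 11 , 1) ∷ (8749 , 1 , 200 , 1 , 13) ∷
      (8749 , 8 , 40 , 18 , 13) ∷ (8749 , 10 , 40 , 18 , 169) ∷ (973 , 10 , 40 , 198 , 13) ∷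
      (973 , 1 , 5000 , 1 , 13) ∷ (2125765 , 91 , 200 , 1 , 1) ∷ (2917 , 10 , 40 , 198 , 13) ∷
      (2917 , 1 , 5000 , 1 , 13) ∷ (730 , 11 , 40 , 18 , 13) ∷ (177148 , 1 , 5 , 1 , 1) ∷
      (8749 , 10 , 40 , 198 , 13) ∷ (8749 , 1 , 5000 , 1 , 13) ∷ (1594324 , 63 , 7 , 1 , 1) ∷
      (1594324 , 91 , 1 , 1 , 1) ∷ (531442 , 70 , 7 , 1 , 1) ∷ (177148 , 1 , 1 , 1 , 1) ∷
      (59051 , 12 , 1 , 1 , 1) ∷ [] )
  ∷ ( (730 , 1 , 8 , 1 , 1) ∷ (13 , 1 , 125 , 1 , 1) ∷ (1 , 8 , 1 , 1 , 13) ∷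
      (1 , 9 , 1 , 1 , 169) ∷ (1 , 8 , 8 , 121 , 1) ∷ (4 , 9 , 8 , 121 , 1) ∷
      (37 , 1 , 15625 , 1 , 1) ∷ (1 , 10 , 1 , 11 , 1) ∷ (4 , 11 , 1 , 11 , 1) ∷
      (4 , 10 , 1 , 18 , 13) ∷ (4 , 11 , 1 , 18 , 169) ∷ (109 , 1 , 78125 , 1 , 1) ∷
      (6562 , 8 , 40 , 1 , 1) ∷ (2188 , 9 , 40 , 1 , 1) ∷ (730 , 10 , 40 , 1 , 1) ∷
      (244 , 11 , 40 , 1 , 1) ∷ (1 , 91 , 1 , 11 , 1) ∷ (325 , 1 , 78125 , 1 , 1) ∷
      (1 , 12 , 125 , 1 , 1) ∷ (1 , 8 , 200 , 121 , 1) ∷ (4 , 9 , 200 , 121 , 1) ∷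
      (6562 , 8 , 200 , 1 , 1) ∷ (2188 , 9 , 200 , 1 , 1) ∷ (730 , 10 , 200 , 1 , 1) ∷
      (6562 , 91 , 40 , 1 , 1) ∷ (26245 , 11 , 200 , 1 , 1) ∷ (26245 , 1 , 1000 , 1 , 1) ∷
      (973 , 1 , 15625 , 1 , 1) ∷ (78733 , 11 , 200 , 1 , 1) ∷ (78733 , 1 , 1000 , 1 , 1) ∷
      (6562 , 91 , 200 , 1 , 1) ∷ (2917 , 1 , 15625 , 1 , 1) ∷ (26245 , 1 , 5000 , 1 , 1) ∷
      (236197 , 1 , 1000 , 1 , 1) ∷ (37 , 8 , 1000 , 121 , 1) ∷ (78733 , 1 , 5000 , 1 , 1) ∷
      (37 , 9 , 1000 , 11 , 1) ∷ (708589 , 1 , 1000 , 1 , 1) ∷ (109 , 8 , 1000 , 121 , 1) ∷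
      (2188 , 1 , 3125 , 1 , 1) ∷ (325 , 1 , 40 , 121 , 1) ∷ (236197 , 1 , 5000 , 1 , 1) ∷
      (37 , 8 , 5000 , 121 , 1) ∷ (109 , 9 , 1000 , 11 , 1) ∷ (37 , 9 , 5000 , 11 , 1) ∷
      (325 , 8 , 1000 , 121 , 1) ∷ (973 , 1 , 40 , 121 , 1) ∷ (1 , 9 , 5 , 11 , 1) ∷
      (4 , 8 , 5 , 11 , 1) ∷ (2125765 , 91 , 1000 , 1 , 1) ∷ (708589 , 91 , 5000 , 1 , 1) ∷
      (6377293 , 91 , 1000 , 1 , 1) ∷ (2125765 , 91 , 5000 , 1 , 1) ∷
      (6377293 , 91 , 5000 , 1 , 1) ∷ (59050 , 11 , 25 , 1 , 1) ∷ (59050 , 8 , 1000 , 1 , 1) ∷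
      (531442 , 91 , 1000 , 1 , 1) ∷ (19684 , 9 , 1000 , 1 , 1) ∷ (531442 , 63 , 1 , 1 , 1) ∷
      (6562 , 10 , 1000 , 1 , 1) ∷ (730 , 1 , 5000 , 1 , 1) ∷ (177148 , 84 , 1 , 1 , 1) ∷
      (59050 , 1 , 1 , 1 , 1) ∷ (59051 , 12 , 7 , 1 , 1) ∷ (19685 , 12 , 35 , 1 , 1) ∷
      (83 , 12 , 25 , 1 , 1) ∷ [] )
  ∷ ( (2188 , 1 , 8 , 1 , 1) ∷ (13 , 1 , 625 , 1 , 1) ∷ (4 , 8 , 1 , 1 , 13) ∷
      (4 , 9 , 1 , 1 , 169) ∷ (37 , 1 , 3125 , 1 , 1) ∷ (37 , 1 , 8 , 121 , 1) ∷
      (13 , 8 , 1 , 121 , 1) ∷ (13 , 10 , 1 , 11 , 1) ∷ (13 , 11 , 8 , 11 , 1) ∷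
      (109 , 1 , 1 , 121 , 1) ∷ (1 , 10 , 8 , 18 , 13) ∷ (1 , 11 , 8 , 18 , 169) ∷
      (109 , 1 , 15625 , 1 , 1) ∷ (325 , 1 , 1 , 121 , 1) ∷ (13 , 91 , 1 , 11 , 1) ∷
      (325 , 1 , 15625 , 1 , 1) ∷ (28 , 10 , 40 , 1 , 1) ∷ (1 , 12 , 625 , 1 , 1) ∷
      (973 , 1 , 1 , 121 , 1) ∷ (730 , 91 , 40 , 1 , 1) ∷ (13 , 9 , 200 , 121 , 1) ∷
      (13 , 11 , 200 , 11 , 1) ∷ (1 , 10 , 200 , 18 , 13) ∷ (1 , 11 , 200 , 18 , 169) ∷
      (2917 , 1 , 8 , 121 , 1) ∷ (82 , 1 , 200 , 1 , 1) ∷ (13 , 9 , 8 , 1 , 1) ∷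
      (37 , 10 , 1 , 198 , 13) ∷ (37 , 11 , 1 , 198 , 169) ∷ (37 , 8 , 200 , 121 , 1) ∷
      (37 , 1 , 1000 , 121 , 1) ∷ (1 , 1 , 40 , 18 , 13) ∷ (37 , 91 , 40 , 11 , 1) ∷
      (13 , 9 , 1000 , 121 , 1) ∷ (37 , 9 , 200 , 11 , 1) ∷ (13 , 11 , 1000 , 11 , 1) ∷
      (109 , 11 , 1 , 198 , 13) ∷ (1 , 10 , 1000 , 18 , 13) ∷ (1 , 11 , 1000 , 18 , 169) ∷
      (244 , 1 , 625 , 1 , 1) ∷ (109 , 10 , 8 , 198 , 13) ∷ (37 , 1 , 5000 , 121 , 1) ∷
      (37 , 91 , 200 , 11 , 1) ∷ (1 , 11 , 40 , 198 , 169) ∷ (730 , 91 , 1000 , 1 , 1) ∷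
      (325 , 10 , 8 , 198 , 13) ∷ (325 , 11 , 8 , 198 , 169) ∷ (2917 , 1 , 40 , 121 , 1) ∷
      (6562 , 8 , 5 , 1 , 1) ∷ (2188 , 11 , 5 , 1 , 1) ∷ (730 , 9 , 5 , 1 , 1) ∷
      (37 , 1 , 5 , 11 , 1) ∷ (973 , 10 , 8 , 198 , 13) ∷ (973 , 11 , 8 , 198 , 169) ∷
      (37 , 10 , 5000 , 18 , 13) ∷ (37 , 11 , 5000 , 18 , 169) ∷ (109 , 10 , 200 , 198 , 13) ∷
      (2917 , 10 , 8 , 198 , 13) ∷ (2917 , 11 , 8 , 198 , 169) ∷ (109 , 10 , 5000 , 18 , 13) ∷
      (109 , 11 , 5000 , 18 , 169) ∷ (2917 , 8 , 1000 , 121 , 1) ∷ (109 , 10 , 1000 , 198 , 13) ∷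
      (2917 , 10 , 1000 , 11 , 1) ∷ (325 , 10 , 5000 , 18 , 13) ∷ (325 , 11 , 5000 , 18 , 169) ∷
      (109 , 10 , 25000 , 18 , 13) ∷ (109 , 11 , 25000 , 18 , 169) ∷ (8749 , 8 , 1000 , 121 , 1) ∷
      (325 , 10 , 1000 , 198 , 13) ∷ (325 , 11 , 1000 , 198 , 169) ∷ (8749 , 10 , 1000 , 11 , 1) ∷
      (109 , 10 , 5000 , 198 , 13) ∷ (325 , 10 , 25000 , 18 , 13) ∷
      (325 , 11 , 25000 , 18 , 169) ∷ (973 , 10 , 1000 , 198 , 13) ∷
      (973 , 11 , 1000 , 198 , 169) ∷ (325 , 10 , 5000 , 198 , 13) ∷
      (325 , 11 , 5000 , 198 , 169) ∷ (109 , 10 , 25000 , 198 , 13) ∷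
      (2917 , 11 , 1000 , 198 , 13) ∷ (13 , 9 , 1 , 1 , 1) ∷ (8749 , 1 , 40 , 121 , 1) ∷
      (325 , 10 , 25000 , 198 , 13) ∷ (325 , 11 , 25000 , 198 , 169) ∷
      (730 , 11 , 1000 , 121 , 1) ∷ (1 , 11 , 5 , 1 , 1) ∷ (82 , 1 , 1000 , 1 , 1) ∷
      (59050 , 1 , 7 , 1 , 1) ∷ (177148 , 63 , 35 , 1 , 1) ∷ (177148 , 63 , 175 , 1 , 1) ∷
      (177148 , 84 , 5 , 1 , 1) ∷ (177148 , 63 , 875 , 1 , 1) ∷ (59050 , 63 , 40 , 1 , 1) ∷
      (19685 , 12 , 1 , 1 , 1) ∷ (59050 , 70 , 175 , 1 , 1) ∷ (59050 , 70 , 875 , 1 , 1) ∷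
      (19684 , 70 , 35 , 1 , 1) ∷ (59050 , 91 , 5 , 1 , 1) ∷ (19684 , 77 , 175 , 1 , 1) ∷
      (2188 , 77 , 35 , 1 , 1) ∷ (19684 , 77 , 875 , 1 , 1) ∷ (19684 , 10 , 5 , 1 , 1) ∷
      (244 , 12 , 5 , 1 , 1) ∷ [] )
  ∷ []

thinAddress : ℕ → ℕ × ℕ × ℕ × ℕ × ℕ → Address
thinAddress n (a , b , c , d , e) =
  (3 , a) ∷ (7 , b) ∷ (5 , c) ∷ (11 , d) ∷ (13 , e) ∷ (19 , 19 + n) ∷ []

-- Assembly and verification

sort : List Congruence → List Congruence
-- Twelve rounds of pairwise merging sort up to 2 ^ 12 congruences; the resulting order is verified
-- by `wellFormed?`.
sort = concat ∘ (λ css → fold css mergePairs 12) ∘ map [_]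
  where
  mergePairs : List (List Congruence) → List (List Congruence)
  mergePairs (cs ∷ ds ∷ ess) = merge _≺?_ cs ds ∷ mergePairs ess
  mergePairs css             = css

covering : List Congruence
covering = sort (map congruence
  (smooth ++ bulk ++ concat (zipWith (map ∘ thinAddress) (upTo 19) thin)))

-- The classes in which the towers accumulate are left to the moduli divisible by 19.
prunings : List Pruning
prunings = ((2 mod 3)        , 11 ∷ 13 ∷ 17 ∷ [])
         ∷ ((1 mod (3 ^ 8))  , 11 ∷ 13 ∷ 17 ∷ [])
         ∷ ((0 mod (5 ^ 7))  , 11 ∷ 13 ∷ 17 ∷ [])
         ∷ ((0 mod (11 ^ 2)) , 13 ∷ 17 ∷ [])
         ∷ ((0 mod (13 ^ 2)) , 17 ∷ [])
         ∷ []

theorem2p7 : ∃[ cs ] (IsCoveringSystem cs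
    × All (λ c → Odd (modulus c) × 1 < modulus c) cs
    × countModulus 21 cs ≡ 5
    × AllPairs (λ c d → modulus c ≢ 21 → modulus d ≢ 21 → modulus c ≢ modulus d) cs)
theorem2p7 =
  -- Both checks are evaluations: `tt` settles the conditions on the list, and the final `refl` runs
  -- the search.
  covering , wellFormed-covering prunings (toWitness {a? = wellFormed? covering} tt) refl
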